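{- For every integer $n\ge 4$, the eccentricity matrix $E(W_n)$ of the wheel graph $W_n$ on $n$ vertices is irreducible.
   Context: A square matrix $A$ of order $n$ is irreducible if there is no permutation matrix $P$ of order $n$ such that $P'AP=\begin{bmatrix}A_1&A_2\\0&A_3\end{bmatrix}$, where $A_1$ and $A_3$ are square matrices of order at least one (the prime denotes transpose). For a simple connected graph $G$ with vertices $v_1,\dots,v_n$, let $d(v_i,v_j)$ be the length of a shortest path between $v_i$ and $v_j$, and let $e(v_i)=\max\{d(v_i,v_j):1\le j\le n\}$ be the eccentricity of $v_i$. The eccentricity matrix $E(G)$ is the $n\times n$ real matrix with $(E(G))_{ij}=d(v_i,v_j)$ if $d(v_i,v_j)=\min\{e(v_i),e(v_j)\}$, and $(E(G))_{ij}=0$ otherwise. For $n\ge 4$, the wheel graph $W_n$ is the graph on $n$ vertices consisting of a cycle of length $n-1$ together with one further vertex (the hub) adjacent to every vertex of the cycle. The vertices are labelled so that $v_1$ is the hub and $v_2,\dots,v_n$ are the cycle vertices in cyclic order. -}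

module Defs where

open import Data.Bool.Base using (if_then_else_)
open import Data.Fin.Base using (Fin; zero; suc; toℕ; cast; splitAt)
open import Data.Fin.Permutation using (Permutation′; _⟨$⟩ʳ_)
open import Data.Fin.Properties as Fin using (any?)
open import Data.Integer.Base as ℤ using (ℤ; +_)
open import Data.Integer.Properties using (+-0-monoid)
open import Data.List.Base using (tabulate)
open import Data.List.Extrema.Nat using (max)
open import Data.Nat.Base using (ℕ; zero; suc; _+_; _≤_; _⊓_; z≤n; s≤s)
open import Data.Nat.Properties as ℕ using (1+n≢n)
open import Data.Product.Base using (Σ; ∃; _×_; _,_; proj₁)
open import Data.Sum.Base using (_⊎_; inj₁; inj₂; swap; [_,_]′)
open import Data.Vec.Base using (Vec; []; _∷_; head; last)
open import Data.Vec.Relation.Unary.All using ([]; _∷_)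
open import Data.Vec.Relation.Unary.AllPairs using ([]; _∷_; allPairs?)
open import Data.Vec.Relation.Unary.Linked using (Linked; [-]; _∷_; linked?)
open import Data.Vec.Relation.Unary.Unique.Propositional using (Unique)
open import Function.Base using (_∘_)
open import Relation.Binary.Definitions using (Symmetric; Irreflexive)
import Relation.Binary.Definitions as B
open import Relation.Binary.PropositionalEquality.Core
  using (_≡_; refl; sym; cong; trans)
open import Relation.Nullary.Decidable
  using (Dec; yes; no; map′; ¬?; _×-dec_; _⊎-dec_; ⌊_⌋)
open import Relation.Nullary.Negation using (¬_; contradiction)
open import Relation.Unary using (Decidable)

import Algebra.Properties.Monoid.Sum +-0-monoid as ℤSum

------------------------------------------------------------------------
-- Matrices

-- The eccentricity matrix has integer entries, as do permutation matrices
-- and all products and blocks of these, so ℤ stands in for the reals.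
Matrix : ℕ → ℕ → Set
Matrix m n = Fin m → Fin n → ℤ

_ᵀ : ∀ {m n} → Matrix m n → Matrix n m
(A ᵀ) i j = A j i

infixl 7 _⊗_
_⊗_ : ∀ {l m n} → Matrix l m → Matrix m n → Matrix l n
(A ⊗ B) i j = ℤSum.sum (λ k → A i k ℤ.* B k j)

permutationMatrix : ∀ {n} → Permutation′ n → Matrix n n
permutationMatrix σ i j = if ⌊ σ ⟨$⟩ʳ i Fin.≟ j ⌋ then + 1 else + 0

-- The block matrix  [ A₁ A₂ ; 0 A₃ ].
blockUpper : ∀ {p q} → Matrix p p → Matrix p q → Matrix q q →
             Matrix (p + q) (p + q)
blockUpper {p} A₁ A₂ A₃ i j with splitAt p i | splitAt p j
... | inj₁ i′ | inj₁ j′ = A₁ i′ j′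
... | inj₁ i′ | inj₂ j′ = A₂ i′ j′
... | inj₂ i′ | inj₁ j′ = + 0
... | inj₂ i′ | inj₂ j′ = A₃ i′ j′

record IsBlockUpper {n} (B : Matrix n n) : Set where
  field
    {p q}  : ℕ
    p≥1    : 1 ≤ p
    q≥1    : 1 ≤ q
    order  : p + q ≡ n
    A₁     : Matrix p p
    A₂     : Matrix p q
    A₃     : Matrix q q
    blocks : ∀ i j → B (cast order i) (cast order j) ≡ blockUpper A₁ A₂ A₃ i j

Irreducible : ∀ {n} → Matrix n n → Set
Irreducible {n} A =
  ¬ Σ (Permutation′ n) λ σ →
      let P = permutationMatrix σ in IsBlockUpper (P ᵀ ⊗ A ⊗ P)

------------------------------------------------------------------------
-- Minimisation and finite search

least : ∀ {P : ℕ → Set} → Decidable P → ∃ P →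
        ∃ λ k → P k × (∀ j → P j → k ≤ j)
least P? w with P? 0
... | yes p₀ = 0 , p₀ , λ _ _ → z≤n
least P? (zero  , p) | no ¬p₀ = contradiction p ¬p₀
least P? (suc k , p) | no ¬p₀ with least (P? ∘ suc) (k , p)
... | m , pm , m≤ = suc m , pm , λ
  { zero    p₀ → contradiction p₀ ¬p₀
  ; (suc j) pj → s≤s (m≤ j pj)
  }

anyVec? : ∀ {n} k {P : Vec (Fin n) k → Set} → Decidable P → Dec (∃ P)
anyVec? zero    P? = map′ ([] ,_) (λ { ([] , p) → p }) (P? [])
anyVec? (suc k) P? =
  map′ (λ { (x , xs , p) → x ∷ xs , p })
       (λ { (x ∷ xs , p) → x , xs , p })
       (any? λ x → anyVec? k (P? ∘ (x ∷_)))

------------------------------------------------------------------------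
-- Simple connected graphs on the vertex set Fin n

-- Path Adj u v k: a path with k edges, that is, k + 1 pairwise distinct
-- vertices from u to v, consecutive ones being adjacent.
Path : ∀ {n} → (Fin n → Fin n → Set) → Fin n → Fin n → ℕ → Set
Path {n} Adj u v k =
  Σ (Vec (Fin n) (suc k)) λ vs →
    head vs ≡ u × last vs ≡ v × Linked Adj vs × Unique vs

record ConnectedGraph (n : ℕ) : Set₁ where
  field
    Adj       : Fin n → Fin n → Set
    adj?      : B.Decidable Adj
    symmetric : Symmetric Adj
    loopless  : Irreflexive _≡_ Adj
    connected : ∀ u v → ∃ (Path Adj u v)

module _ {n : ℕ} (G : ConnectedGraph n) where
  open ConnectedGraph G

  path? : ∀ u v → Decidable (Path Adj u v)
  path? u v k = anyVec? (suc k) λ vs →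
    (head vs Fin.≟ u) ×-dec (last vs Fin.≟ v) ×-dec
    linked? adj? vs ×-dec allPairs? (λ x y → ¬? (x Fin.≟ y)) vs

  shortestPath : ∀ u v →
    ∃ λ k → Path Adj u v k × (∀ j → Path Adj u v j → k ≤ j)
  shortestPath u v = least (path? u v) (connected u v)

  dist : Fin n → Fin n → ℕ
  dist u v = proj₁ (shortestPath u v)

  ecc : Fin n → ℕ
  ecc u = max 0 (tabulate (dist u))

  eccentricityMatrix : Matrix n n
  eccentricityMatrix u v =
    if ⌊ dist u v ℕ.≟ ecc u ⊓ ecc v ⌋ then + dist u v else + 0

------------------------------------------------------------------------
-- Wheel graphs

-- CycleNext i j: j is the successor of i in the cyclic order 0, 1, …, m - 1.
CycleNext : ∀ {m} → Fin m → Fin m → Set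
CycleNext {m} i j =
  toℕ j ≡ suc (toℕ i) ⊎ (suc (toℕ i) ≡ m × toℕ j ≡ 0)

CycleAdj : ∀ {m} → Fin m → Fin m → Set
CycleAdj i j = CycleNext i j ⊎ CycleNext j i

-- On Fin (1 + m): zero is the hub, and suc i is the i-th vertex of the
-- cycle of length m.
data WheelAdj {m : ℕ} : Fin (suc m) → Fin (suc m) → Set where
  hub-rim : ∀ {i} → WheelAdj zero (suc i)
  rim-hub : ∀ {i} → WheelAdj (suc i) zero
  rim-rim : ∀ {i j} → CycleAdj i j → WheelAdj (suc i) (suc j)

cycleNext? : ∀ {m} → B.Decidable (CycleNext {m})
cycleNext? {m} i j =
  (toℕ j ℕ.≟ suc (toℕ i)) ⊎-dec ((suc (toℕ i) ℕ.≟ m) ×-dec (toℕ j ℕ.≟ 0))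

wheelAdj? : ∀ {m} → B.Decidable (WheelAdj {m})
wheelAdj? zero    zero    = no λ ()
wheelAdj? zero    (suc j) = yes hub-rim
wheelAdj? (suc i) zero    = yes rim-hub
wheelAdj? (suc i) (suc j) =
  map′ rim-rim (λ { (rim-rim a) → a }) (cycleNext? i j ⊎-dec cycleNext? j i)

wheelAdj-sym : ∀ {m} → Symmetric (WheelAdj {m})
wheelAdj-sym hub-rim     = rim-hub
wheelAdj-sym rim-hub     = hub-rim
wheelAdj-sym (rim-rim a) = rim-rim (swap a)

cycleNext-irrefl : ∀ {m} → 3 ≤ m → (i : Fin m) → ¬ CycleNext i i
cycleNext-irrefl _   i (inj₁ i≡1+i) = 1+n≢n (sym i≡1+i)
cycleNext-irrefl 3≤m i (inj₂ (1+i≡m , i≡0))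
  with trans (sym (cong suc i≡0)) 1+i≡m | 3≤m
... | refl | s≤s ()

wheelAdj-irrefl : ∀ {m} → 3 ≤ m → Irreflexive _≡_ (WheelAdj {m})
wheelAdj-irrefl 3≤m {suc i} refl (rim-rim a) =
  [ cycleNext-irrefl 3≤m i , cycleNext-irrefl 3≤m i ]′ a

wheelAdj-connected : ∀ {m} (u v : Fin (suc m)) → ∃ (Path WheelAdj u v)
wheelAdj-connected u v with u Fin.≟ v
wheelAdj-connected u u | yes refl =
  0 , u ∷ [] , refl , refl , [-] , [] ∷ []
wheelAdj-connected zero zero | no u≢v = contradiction refl u≢v
wheelAdj-connected zero (suc j) | no u≢v =
  1 , zero ∷ suc j ∷ [] , refl , refl ,
  hub-rim ∷ [-] , (u≢v ∷ []) ∷ [] ∷ []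
wheelAdj-connected (suc i) zero | no u≢v =
  1 , suc i ∷ zero ∷ [] , refl , refl ,
  rim-hub ∷ [-] , (u≢v ∷ []) ∷ [] ∷ []
wheelAdj-connected (suc i) (suc j) | no u≢v =
  2 , suc i ∷ zero ∷ suc j ∷ [] , refl , refl ,
  rim-hub ∷ hub-rim ∷ [-] ,
  ((λ ()) ∷ u≢v ∷ []) ∷ ((λ ()) ∷ []) ∷ [] ∷ []

wheel : ∀ n → 4 ≤ n → ConnectedGraph n
wheel (suc m) (s≤s 3≤m) = record
  { Adj       = WheelAdj
  ; adj?      = wheelAdj?
  ; symmetric = wheelAdj-sym
  ; loopless  = wheelAdj-irrefl 3≤m
  ; connected = wheelAdj-connected
  }

{-# OPTIONS --safe #-}

-- The hub has eccentricity 1 and is at distance 1 from every other vertex, so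
-- every off-diagonal entry of its row and column in E(Wₙ) is nonzero.
-- In the form P'E(Wₙ)P = [ A₁ A₂ ; 0 A₃ ] the hub indexes a row either
-- through the zero block or through A₁; in the latter case its column runs
-- through the zero block. Both are impossible, as the block is nonempty.

module Submission where

open import Defs
open import Data.Fin.Base using (Fin; zero; suc; splitAt; fromℕ<; _↑ˡ_; _↑ʳ_)
open import Data.Fin.Permutation using (Permutation′; _⟨$⟩ʳ_; _⟨$⟩ˡ_; inverseʳ; inverseˡ)
open import Data.Fin.Properties as Fin
  using (splitAt-↑ˡ; splitAt-↑ʳ; splitAt⁻¹-↑ˡ; splitAt⁻¹-↑ʳ; cast-is-id)
open import Data.Integer.Base as ℤ using (ℤ; +_)
import Data.Integer.Properties as ℤ
open import Data.List.Base using (tabulate)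
open import Data.List.Extrema.Nat using (max≤v⁺; xs≤max)
import Data.List.Relation.Unary.All.Properties as All
open import Data.Nat.Base using (ℕ; zero; suc; _≤_; _⊓_; z≤n; s≤s)
open import Data.Nat.Properties as ℕ
  using (≤-antisym; ≤-trans; ≤-reflexive; ⊓-glb; m⊓n≤m; m⊓n≤n)
open import Data.Product.Base using (_×_; _,_; proj₁; proj₂)
open import Data.Sum.Base using (inj₁; inj₂)
open import Data.Vec.Base using ([]; _∷_)
open import Data.Vec.Relation.Unary.All using ([]; _∷_)
open import Data.Vec.Relation.Unary.AllPairs using ([]; _∷_)
open import Data.Vec.Relation.Unary.Linked using ([-]; _∷_)
open import Function.Base using (_∘_)
open import Relation.Binary.PropositionalEquality
  using (_≡_; _≢_; refl; sym; trans; cong; cong₂; module ≡-Reasoning)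
open import Relation.Nullary.Decidable using (yes; no)
open import Relation.Nullary.Negation using (¬_; contradiction)

import Algebra.Properties.Monoid.Sum ℤ.+-0-monoid as ℤSum

sum-single : ∀ {n} (f : Fin n → ℤ) k → (∀ i → i ≢ k → f i ≡ + 0) →
             ℤSum.sum f ≡ f k
sum-single {suc n} f zero f≡0 = begin
  f zero ℤ.+ ℤSum.sum (f ∘ suc)
    ≡⟨ cong (λ s → f zero ℤ.+ s) (ℤSum.sum-cong-≗ λ i → f≡0 (suc i) λ ()) ⟩
  f zero ℤ.+ ℤSum.sum {n} (λ _ → + 0)
    ≡⟨ cong (λ s → f zero ℤ.+ s) (ℤSum.sum-replicate-zero n) ⟩
  f zero ℤ.+ + 0
    ≡⟨ ℤ.+-identityʳ (f zero) ⟩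
  f zero ∎
  where open ≡-Reasoning
sum-single f (suc k) f≡0 = begin
  f zero ℤ.+ ℤSum.sum (f ∘ suc)
    ≡⟨ cong₂ ℤ._+_ (f≡0 zero λ ())
         (sum-single (f ∘ suc) k λ i i≢k → f≡0 (suc i) (i≢k ∘ Fin.suc-injective)) ⟩
  + 0 ℤ.+ f (suc k)
    ≡⟨ ℤ.+-identityˡ (f (suc k)) ⟩
  f (suc k) ∎
  where open ≡-Reasoning

module _ {n} (σ : Permutation′ n) where

  private
    P = permutationMatrix σ

  permutationMatrix-on : ∀ k → P k (σ ⟨$⟩ʳ k) ≡ + 1
  permutationMatrix-on k with σ ⟨$⟩ʳ k Fin.≟ σ ⟨$⟩ʳ k
  ... | yes _ = refl
  ... | no ≢ = contradiction refl ≢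

  permutationMatrix-off : ∀ {i k} → i ≢ k → P i (σ ⟨$⟩ʳ k) ≡ + 0
  permutationMatrix-off {i} {k} i≢k with σ ⟨$⟩ʳ i Fin.≟ σ ⟨$⟩ʳ k
  ... | no _ = refl
  ... | yes σi≡σk = contradiction
    (trans (sym (inverseˡ σ)) (trans (cong (σ ⟨$⟩ˡ_) σi≡σk) (inverseˡ σ))) i≢k

  -- Column `σ ⟨$⟩ʳ k` of `P` has its only `+ 1` in row `k`, so one term of the sum survives.
  -- Writing the column as an image under `σ` keeps the inverse out of the computation.
  ⊗-permutationMatrix : ∀ {m} (A : Matrix m n) i k →
                        (A ⊗ P) i (σ ⟨$⟩ʳ k) ≡ A i k
  ⊗-permutationMatrix A i k = begin
    (A ⊗ P) i (σ ⟨$⟩ʳ k)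
      ≡⟨ sum-single _ k (λ l l≢k →
           trans (cong (A i l ℤ.*_) (permutationMatrix-off l≢k)) (ℤ.*-zeroʳ (A i l))) ⟩
    A i k ℤ.* P k (σ ⟨$⟩ʳ k)
      ≡⟨ cong (A i k ℤ.*_) (permutationMatrix-on k) ⟩
    A i k ℤ.* + 1
      ≡⟨ ℤ.*-identityʳ (A i k) ⟩
    A i k ∎
    where open ≡-Reasoning

  permutationMatrixᵀ-⊗ : ∀ {m} (A : Matrix n m) k j →
                         (P ᵀ ⊗ A) (σ ⟨$⟩ʳ k) j ≡ A k j
  permutationMatrixᵀ-⊗ A k j = begin
    (P ᵀ ⊗ A) (σ ⟨$⟩ʳ k) j
      -- A left factor `+ 0` reduces the product to `+ 0` by computation.
      ≡⟨ sum-single _ k (λ l l≢k → cong (ℤ._* A l j) (permutationMatrix-off l≢k)) ⟩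
    P k (σ ⟨$⟩ʳ k) ℤ.* A k j
      ≡⟨ cong (ℤ._* A k j) (permutationMatrix-on k) ⟩
    + 1 ℤ.* A k j
      ≡⟨ ℤ.*-identityˡ (A k j) ⟩
    A k j ∎
    where open ≡-Reasoning

  -- Since `P` has its ones at `(k , σ k)`, conjugation carries the entry at `(k , l)` to
  -- `(σ k , σ l)`. Each index is therefore first written as the image of its preimage.
  conjugate-entry : ∀ (A : Matrix n n) i j →
                    (P ᵀ ⊗ A ⊗ P) i j ≡ A (σ ⟨$⟩ˡ i) (σ ⟨$⟩ˡ j)
  conjugate-entry A i j = begin
    (P ᵀ ⊗ A ⊗ P) i j
      ≡⟨ cong₂ (P ᵀ ⊗ A ⊗ P) (inverseʳ σ) (inverseʳ σ) ⟨
    (P ᵀ ⊗ A ⊗ P) (σ ⟨$⟩ʳ (σ ⟨$⟩ˡ i)) (σ ⟨$⟩ʳ (σ ⟨$⟩ˡ j))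
      ≡⟨ ⊗-permutationMatrix (P ᵀ ⊗ A) _ _ ⟩
    (P ᵀ ⊗ A) (σ ⟨$⟩ʳ (σ ⟨$⟩ˡ i)) (σ ⟨$⟩ˡ j)
      ≡⟨ permutationMatrixᵀ-⊗ A _ _ ⟩
    A (σ ⟨$⟩ˡ i) (σ ⟨$⟩ˡ j) ∎
    where open ≡-Reasoning

blockUpper-lowerLeft : ∀ {p q} (A₁ : Matrix p p) A₂ (A₃ : Matrix q q) i j →
                       blockUpper A₁ A₂ A₃ (p ↑ʳ i) (j ↑ˡ q) ≡ + 0
blockUpper-lowerLeft {p} {q} A₁ A₂ A₃ i j
  rewrite splitAt-↑ʳ p q i | splitAt-↑ˡ p j q = refl

↑ʳ≢↑ˡ : ∀ {p q} {i : Fin q} {j : Fin p} → p ↑ʳ i ≢ j ↑ˡ q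
↑ʳ≢↑ˡ {p} {q} {i} {j} eq
  with () ← trans (sym (splitAt-↑ʳ p q i)) (trans (cong (splitAt p) eq) (splitAt-↑ˡ p j q))

-- The entry at `(h , h)` is left free because the diagonal of an eccentricity matrix is zero.
FullCross : ∀ {n} → Matrix n n → Fin n → Set
FullCross A h = ∀ k → k ≢ h → A h k ≢ + 0 × A k h ≢ + 0

fullCross⇒¬blockUpper : ∀ {n} {B : Matrix n n} {h} → FullCross B h → ¬ IsBlockUpper B
fullCross⇒¬blockUpper {B = B} {h} cross
  -- Matching `order` with `refl` makes the size literally `p + q`, so that `cast` is the identity.
  record { p = p ; q = q ; p≥1 = p≥1 ; q≥1 = q≥1 ; order = refl
         ; A₁ = A₁ ; A₂ = A₂ ; A₃ = A₃ ; blocks = blocks } = h-nowhere (splitAt p h) refl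
  where
  lowerLeft : ∀ i j → B (p ↑ʳ i) (j ↑ˡ q) ≡ + 0
  lowerLeft i j = trans (sym (cong₂ B (cast-is-id refl _) (cast-is-id refl _)))
    (trans (blocks _ _) (blockUpper-lowerLeft A₁ A₂ A₃ i j))

  h-nowhere : ∀ s → splitAt p h ≢ s
  -- The first row of the lower part meets column `h` inside the zero block; it differs from `h`,
  -- which lies in the upper part, so the entry is off the diagonal.
  h-nowhere (inj₁ j) eq with refl ← splitAt⁻¹-↑ˡ eq =
    proj₂ (cross (p ↑ʳ fromℕ< q≥1) ↑ʳ≢↑ˡ) (lowerLeft (fromℕ< q≥1) j)
  -- Symmetrically, row `h` meets the first column of the left part inside the zero block.
  h-nowhere (inj₂ i) eq with refl ← splitAt⁻¹-↑ʳ {p} eq =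
    proj₁ (cross (fromℕ< p≥1 ↑ˡ q) (↑ʳ≢↑ˡ ∘ sym)) (lowerLeft i (fromℕ< p≥1))

-- Conjugation permutes rows and columns alike, so the cross moves with its centre, and off-diagonal
-- positions stay off the diagonal.
fullCross-conjugate : ∀ {n} (A : Matrix n n) {h} (σ : Permutation′ n) →
  let P = permutationMatrix σ in
  FullCross A h → FullCross (P ᵀ ⊗ A ⊗ P) (σ ⟨$⟩ʳ h)
fullCross-conjugate A {h} σ cross k k≢σh =
  let row , col = cross (σ ⟨$⟩ˡ k) σ⁻¹k≢h in
  (λ ≡0 → row (trans (cong (λ x → A x _) (sym (inverseˡ σ)))
            (trans (sym (conjugate-entry σ A _ k)) ≡0))) ,
  (λ ≡0 → col (trans (cong (A _) (sym (inverseˡ σ)))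
            (trans (sym (conjugate-entry σ A k _)) ≡0)))
  where
  σ⁻¹k≢h : σ ⟨$⟩ˡ k ≢ h
  σ⁻¹k≢h σ⁻¹k≡h = k≢σh (trans (sym (inverseʳ σ)) (cong (σ ⟨$⟩ʳ_) σ⁻¹k≡h))

fullCross⇒irreducible : ∀ {n} (A : Matrix n n) {h} → FullCross A h → Irreducible A
fullCross⇒irreducible A cross (σ , B-blockUpper) =
  fullCross⇒¬blockUpper (fullCross-conjugate A σ cross) B-blockUpper

module _ {n} (G : ConnectedGraph n) where
  open ConnectedGraph G

  dist-refl : ∀ u → dist G u u ≡ 0
  dist-refl u = ℕ.n≤0⇒n≡0
    (proj₂ (proj₂ (shortestPath G u u)) 0 (u ∷ [] , refl , refl , [-] , [] ∷ []))

  dist-adj : ∀ {u v} → Adj u v → dist G u v ≡ 1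
  dist-adj {u} {v} uv with shortestPath G u v
  -- A path without edges has a single vertex, so `uv` would be a loop.
  ... | zero , (_ ∷ [] , refl , refl , _) , _ = contradiction uv (loopless refl)
  ... | suc k , _ , minimal = ≤-antisym (minimal 1 edge) (s≤s z≤n)
    where
    edge : Path Adj u v 1
    edge = u ∷ v ∷ [] , refl , refl , uv ∷ [-] ,
           ((λ u≡v → loopless u≡v uv) ∷ []) ∷ [] ∷ []

  dist≤ecc : ∀ u v → dist G u v ≤ ecc G u
  dist≤ecc u = All.tabulate⁻ (xs≤max 0 (tabulate (dist G u)))

  ecc-lub : ∀ {u b} → (∀ v → dist G u v ≤ b) → ecc G u ≤ b
  -- `z≤n` bounds the starting value 0 of `max`.
  ecc-lub dist≤b = max≤v⁺ z≤n (All.tabulate⁺ dist≤b)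

  eccentricityMatrix-entry : ∀ {u v} → dist G u v ≡ ecc G u ⊓ ecc G v →
                             eccentricityMatrix G u v ≡ + dist G u v
  eccentricityMatrix-entry {u} {v} d≡ with dist G u v ℕ.≟ ecc G u ⊓ ecc G v
  ... | yes _ = refl
  ... | no d≢ = contradiction d≡ d≢

  adj⇒1≤ecc : ∀ {u v} → Adj u v → 1 ≤ ecc G u
  adj⇒1≤ecc {u} {v} uv = ≤-trans (≤-reflexive (sym (dist-adj uv))) (dist≤ecc u v)

  -- Each endpoint of an edge has eccentricity at least 1, so the bound forces the minimum to be
  -- exactly 1, the distance of `u` and `v`.
  eccentricityMatrix-adj : ∀ {u v} → Adj u v → ecc G u ⊓ ecc G v ≤ 1 →
                           eccentricityMatrix G u v ≡ + 1
  eccentricityMatrix-adj {u} {v} uv ⊓≤1 = trans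
    (eccentricityMatrix-entry (trans (dist-adj uv)
      (≤-antisym (⊓-glb (adj⇒1≤ecc uv) (adj⇒1≤ecc (symmetric uv))) ⊓≤1)))
    (cong +_ (dist-adj uv))

  module _ {h} (universal : ∀ k → k ≢ h → Adj h k) where

    universal⇒ecc≤1 : ecc G h ≤ 1
    universal⇒ecc≤1 = ecc-lub dist≤1
      where
      dist≤1 : ∀ v → dist G h v ≤ 1
      dist≤1 v with v Fin.≟ h
      ... | yes refl = ≤-trans (≤-reflexive (dist-refl h)) z≤n
      ... | no v≢h = ≤-reflexive (dist-adj (universal v v≢h))

    -- The eccentricity of `h` caps the minimum at 1 whatever the eccentricity of `k`.
    universal⇒fullCross : FullCross (eccentricityMatrix G) h
    universal⇒fullCross k k≢h =
      ≢0 (eccentricityMatrix-adj hk (≤-trans (m⊓n≤m _ _) universal⇒ecc≤1)) ,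
      ≢0 (eccentricityMatrix-adj (symmetric hk) (≤-trans (m⊓n≤n _ _) universal⇒ecc≤1))
      where
      hk : Adj h k
      hk = universal k k≢h
      ≢0 : ∀ {x} → x ≡ + 1 → x ≢ + 0
      ≢0 refl ()

    universal⇒irreducible : Irreducible (eccentricityMatrix G)
    universal⇒irreducible =
      fullCross⇒irreducible (eccentricityMatrix G) universal⇒fullCross

hub-universal : ∀ {n} (n≥4 : 4 ≤ suc n) k → k ≢ zero →
                ConnectedGraph.Adj (wheel (suc n) n≥4) zero k
-- `wheel` is defined by matching on the bound, so its `Adj` unfolds to `WheelAdj` only once `s≤s`
-- is exposed.
hub-universal (s≤s _) zero    0≢0 = contradiction refl 0≢0
hub-universal (s≤s _) (suc _) _   = hub-rim

proposition2p3 : (n : ℕ) (n≥4 : 4 ≤ n) → Irreducible (eccentricityMatrix (wheel n n≥4))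
proposition2p3 (suc n) n≥4 =
  universal⇒irreducible (wheel (suc n) n≥4) {zero} (hub-universal n≥4)
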